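{- In the axiom system $\mathtt{TMM}\setminus\{\mathtt{spec}\}$, the scheme $\mathtt{ALLeq}$ cannot be weakened by adding any disjoint variable condition: for each $D\in\{\{x,y\},\{x,\phi\},\{y,\phi\}\}$, the scheme $\mathtt{ALLeq}$ (i.e. $\forall x\,x\equiv y\to(\forall x\,\phi\to\forall y\,\phi)$ without disjoint variable conditions) is not provable from the set of schemes consisting of $\mathtt{TMM}\setminus\{\mathtt{spec},\mathtt{ALLeq}\}$ together with the scheme $(\forall x\,x\equiv y\to(\forall x\,\phi\to\forall y\,\phi),\ \{D\})$. In particular, $\mathtt{ALLeq}$ is independent in $\mathtt{TMM}\setminus\{\mathtt{spec}\}$.
   Context: **Metavariables and metaformulas.** Let $\mathrm{vrMV}=\{x_i\mid i\in\omega\}$ (variable metavariables) and $\mathrm{fmMV}=\{\phi_i\mid i\in\omega\}$ (formula metavariables) be disjoint countably infinite sets of symbols, and $\mathrm{MV}=\mathrm{vrMV}\cup\mathrm{fmMV}$. A language $\mathcal L$ is a set of further symbols (nonlogical predicates) with an arity function $\mathcal L\to\omega$. Fix a language $\mathcal L$. A metaformula is one of: a formula metavariable; $x_i\equiv x_j$; $P(x_{i_1},\dots,x_{i_r})$ with $P\in\mathcal L$ of arity $r$; $\forall x_i\,\Phi$; $\neg\Phi$; $\Phi\to\Psi$, where $\Phi,\Psi$ are metaformulas. $\mathrm{MF}$ is the set of metaformulas. $\mathrm{OC}(\Phi)\subseteq\mathrm{MV}$ is the set of metavariables occurring in $\Phi$ (including those directly after a quantifier), and $\mathrm{OC}(x_i)=\{x_i\}$.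 For a set $X$, $\mathcal P_2(X)$ is the set of its two-element subsets. **Schemes.** A scheme $\Phi=(\{\Phi_1,\dots,\Phi_n\},\Phi_0,\mathrm{DV}(\Phi))$ consists of a finite set of metaformulas (hypotheses), a metaformula (conclusion), and a set $\mathrm{DV}(\Phi)\subseteq\mathcal P_2(\mathrm{OC}(\Phi))$ (disjoint variable conditions), where $\mathrm{OC}(\Phi)$ is the set of metavariables occurring in its hypotheses or conclusion. Writing $(\Phi_I,\Phi_0,D)$ with a larger $D$ means that $D$ is intersected with $\mathcal P_2(\mathrm{OC}(\Phi))$. Such a scheme is displayed as $\Phi_1\;\&\;\dots\;\&\;\Phi_n\Longrightarrow\Phi_0,\ \mathrm{DV}(\cdot,\cdot),\dots$, where $\mathrm{DV}(m,n)$ denotes the condition $\{m,n\}$; a scheme without hypotheses is written $(\Phi_0,\mathrm{DV}(\Phi))$. **Substitution and instances.** A substitution is a map $\sigma:\mathrm{MV}\to\mathrm{vrMV}\cup\mathrm{MF}$ with $\sigma(\mathrm{vrMV})\subseteq\mathrm{vrMV}$, $\sigma(\mathrm{fmMV})\subseteq\mathrm{MF}$ and $\sigma(m)=m$ for all but finitely many $m$. $\Phi^\sigma$ is the result of simultaneous plain substitution in the metaformula $\Phi$ (variable metavariables after quantifiers are also replaced). For $D\subseteq\mathcal P_2(\mathrm{MV})$, $D^\sigma=\{\{m,n\}\in\mathcal P_2(\mathrm{MV})\mid\exists\{m',n'\}\in D,\ m\in\mathrm{OC}(\sigma(m')),\ n\in\mathrm{OC}(\sigma(n'))\}$. $\sigma$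 is legitimate on a scheme $\Phi$ if $\{m,n\}\in\mathrm{DV}(\Phi)$ implies $\mathrm{OC}(\sigma(m))\cap\mathrm{OC}(\sigma(n))=\varnothing$. A scheme $\Psi$ is an instance of $\Phi$ if for some $\sigma$ legitimate on $\Phi$ the hypotheses and conclusion of $\Psi$ are the images under $\sigma$ of those of $\Phi$ and $\mathrm{DV}(\Phi)^\sigma\subseteq\mathrm{DV}(\Psi)$. **Proofs.** A proof of a scheme $\Phi$ from a set of schemes $S$ is a finite sequence $P$ of metaformulas (lines) whose last line is the conclusion of $\Phi$ and such that each line $P_i$ that is not a hypothesis of $\Phi$ admits $i_1,\dots,i_n<i$ for which $(\{P_{i_1},\dots,P_{i_n}\},P_i,\mathrm{DV}(P))$ is an instance of a scheme in $S$, where $\mathrm{DV}(P)=\mathrm{DV}(\Phi)\cup\{\{m,n\}\mid m\in\mathrm{OC}(P)\setminus\mathrm{OC}(\Phi),\ n\in\mathrm{OC}(P),\ m\ne n\}$ and $\mathrm{OC}(P)$ is the set of metavariables occurring in the lines of $P$ (or in $\Phi$). $\Phi$ is provable from $S$ if such a proof exists. A scheme is independent in a set of schemes containing it if it is not provable from the other schemes of that set. (Provability does not depend on the choice of the language containing the symbols involved.) **The system $\mathtt{TMM}$.** With $x,y,z$ distinct variable metavariables and $\phi,\psi,\chi,\theta,\tau$ distinct formula metavariables, $\mathtt{TMM}$ is the set of the following schemes: - $\mathtt{mp}$: $\phi\;\&\;\phi\to\psi\Longrightarrow\psi$ - $\mathtt{minimp}$: $\phi\to((\psi\to\chi)\to(((\theta\to\psi)\to(\chi\to\tau))\to(\psi\to\tau)))$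 - $\mathtt{peirce}$: $((\phi\to\psi)\to\phi)\to\phi$ - $\mathtt{contrap}$: $(\phi\to\neg\psi)\to(\psi\to\neg\phi)$ - $\mathtt{notelim}$: $\neg\phi\to(\phi\to\psi)$ - $\mathtt{gen}$: $\phi\Longrightarrow\forall x\,\phi$ - $\mathtt{ALLdistr}$: $\forall x(\phi\to\psi)\to(\forall x\,\phi\to\forall x\,\psi)$ - $\mathtt{spec}$: $\forall x\,\phi\to\phi$ - $\mathtt{modal5}$: $\neg\forall x\,\phi\to\forall x\,\neg\forall x\,\phi$ - $\mathtt{vacGen}$: $\phi\to\forall x\,\phi,\ \mathrm{DV}(x,\phi)$ - $\mathtt{ALLcomm}$: $\forall x\forall y\,\phi\to\forall y\forall x\,\phi$ - $\mathtt{EQrefl}$: $x\equiv x$ - $\mathtt{EQsymm}$: $x\equiv y\to y\equiv x$ - $\mathtt{EQtrans}$: $x\equiv y\to(y\equiv z\to x\equiv z)$ - $\mathtt{denot}$: $x\equiv x\to\neg\forall y\,\neg\,y\equiv x,\ \mathrm{DV}(x,y)$ - $\mathtt{subst}$: $\forall x(x\equiv y\to(\phi\to\forall x(x\equiv y\to\phi))),\ \mathrm{DV}(x,y),\ \mathrm{DV}(y,\phi)$ - $\mathtt{ALLeq}$: $\forall x\,x\equiv y\to(\forall x\,\phi\to\forall y\,\phi)$ - $\mathtt{genEq}$: $\neg\forall x\,x\equiv y\to(\neg\forall x\,x\equiv z\to(y\equiv z\to\forall x\,y\equiv z))$ -}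

module Defs where

open import Data.Empty using (⊥)
open import Data.Fin using (Fin; _<_)
open import Data.List using (List; []; _∷_; _++_; map; concatMap)
open import Data.List.Membership.Propositional using (_∈_; _∉_)
open import Data.List.Relation.Binary.BagAndSetEquality using (_∼[_]_; set)
open import Data.List.Relation.Unary.All using (All)
open import Data.Nat using (ℕ; suc)
open import Data.Product using (∃-syntax; _×_; _,_)
open import Data.Sum using (_⊎_; inj₁; inj₂)
open import Data.Vec using (Vec; lookup; last; toList)
import Data.Vec as Vec
open import Level using (0ℓ) renaming (suc to lsuc)
open import Relation.Binary using (Rel; Symmetric; Irreflexive)
open import Relation.Binary.PropositionalEquality using (_≡_; _≢_; refl; sym; trans; ≢-sym)
open import Relation.Nullary using (¬_)
open import Relation.Unary using (Pred; _∖_; ｛_｝)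

data VrMV : Set where
  x⟨_⟩ : ℕ → VrMV

data FmMV : Set where
  φ⟨_⟩ : ℕ → FmMV

data MV : Set where
  vr : VrMV → MV
  fm : FmMV → MV

-- A set of two-element subsets of MV, given as a symmetric irreflexive
-- relation: Disj m n says that {m , n} belongs to the set.
record DVSet : Set₁ where
  field
    Disj   : Rel MV 0ℓ
    symm   : Symmetric Disj
    irrefl : Irreflexive _≡_ Disj

open DVSet public

infix 4 _⊆ᴰ_
_⊆ᴰ_ : DVSet → DVSet → Set
D ⊆ᴰ E = ∀ {m n} → Disj D m n → Disj E m n

noDV : DVSet
noDV .Disj _ _ = ⊥
noDV .symm ()
noDV .irrefl _ ()

-- The set {{a , b}} whose only element is the pair {a , b}.
dv : (a b : MV) → a ≢ b → DVSet
dv a b a≢b .Disj m n = (m ≡ a × n ≡ b) ⊎ (m ≡ b × n ≡ a)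
dv a b a≢b .symm (inj₁ (p , q)) = inj₂ (q , p)
dv a b a≢b .symm (inj₂ (p , q)) = inj₁ (q , p)
dv a b a≢b .irrefl refl (inj₁ (p , q)) = a≢b (trans (sym p) q)
dv a b a≢b .irrefl refl (inj₂ (p , q)) = a≢b (trans (sym q) p)

infixr 6 _∪ᴰ_
_∪ᴰ_ : DVSet → DVSet → DVSet
(D ∪ᴰ E) .Disj m n = Disj D m n ⊎ Disj E m n
(D ∪ᴰ E) .symm (inj₁ d) = inj₁ (symm D d)
(D ∪ᴰ E) .symm (inj₂ e) = inj₂ (symm E e)
(D ∪ᴰ E) .irrefl p (inj₁ d) = irrefl D p d
(D ∪ᴰ E) .irrefl p (inj₂ e) = irrefl E p e

-- The intersection of D with the two-element subsets of X.
infix 7 _↾_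
_↾_ : DVSet → List MV → DVSet
(D ↾ X) .Disj m n = Disj D m n × m ∈ X × n ∈ X
(D ↾ X) .symm (d , p , q) = symm D d , q , p
(D ↾ X) .irrefl p (d , _) = irrefl D p d

record Language : Set₁ where
  field
    Symbol : Set
    arity  : Symbol → ℕ

module System (𝓛 : Language) where
  open Language 𝓛

  infix  35 _≐_
  infixr 30 ∀[_]_ ∼_
  infixr 20 _⇒_

  data MF : Set where
    mv    : FmMV → MF
    _≐_   : VrMV → VrMV → MF
    atom  : (P : Symbol) → Vec VrMV (arity P) → MF
    ∀[_]_ : VrMV → MF → MF
    ∼_    : MF → MF
    _⇒_   : MF → MF → MF

  OC : MF → List MV
  OC (mv a)      = fm a ∷ []
  OC (u ≐ v)     = vr u ∷ vr v ∷ []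
  OC (atom P us) = map vr (toList us)
  OC (∀[ u ] A)  = vr u ∷ OC A
  OC (∼ A)       = OC A
  OC (A ⇒ B)     = OC A ++ OC B

  record Scheme : Set₁ where
    field
      hyps  : List MF
      concl : MF

    OCˢ : List MV
    OCˢ = concatMap OC (concl ∷ hyps)

    field
      DV   : DVSet
      DV⊆ : ∀ {m n} → Disj DV m n → m ∈ OCˢ × n ∈ OCˢ

  open Scheme public

  -- The DV set is cut down to the metavariables occurring in the scheme.
  scheme : List MF → MF → DVSet → Scheme
  scheme Γ A D = record
    { hyps  = Γ
    ; concl = A
    ; DV    = D ↾ concatMap OC (A ∷ Γ)
    ; DV⊆  = λ (_ , m∈ , n∈) → m∈ , n∈
    }

  record Substitution : Set where
    field
      onVr : VrMV → VrMV
      onFm : FmMV → MF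
      supp : List MV
      finVr : ∀ u → vr u ∉ supp → onVr u ≡ u
      finFm : ∀ a → fm a ∉ supp → onFm a ≡ mv a

    apply : MF → MF
    apply (mv a)      = onFm a
    apply (u ≐ v)     = onVr u ≐ onVr v
    apply (atom P us) = atom P (Vec.map onVr us)
    apply (∀[ u ] A)  = ∀[ onVr u ] apply A
    apply (∼ A)       = ∼ apply A
    apply (A ⇒ B)     = apply A ⇒ apply B

    -- OC (σ m)
    OCσ : MV → List MV
    OCσ (vr u) = vr (onVr u) ∷ []
    OCσ (fm a) = OC (onFm a)

    applyDV : DVSet → DVSet
    applyDV D .Disj m n =
      m ≢ n × ∃[ m′ ] ∃[ n′ ] (Disj D m′ n′ × m ∈ OCσ m′ × n ∈ OCσ n′)
    applyDV D .symm (m≢n , m′ , n′ , d , p , q) =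
      ≢-sym m≢n , n′ , m′ , symm D d , q , p
    applyDV D .irrefl m≡n (m≢n , _) = m≢n m≡n

    Legitimate : Scheme → Set
    Legitimate Φ = ∀ {m n} → Disj (DV Φ) m n → ∀ {k} → ¬ (k ∈ OCσ m × k ∈ OCσ n)

  record _IsInstanceOf_ (Ψ Φ : Scheme) : Set where
    field
      σ : Substitution
    open Substitution σ
    field
      legitimate : Legitimate Φ
      hyps-image : hyps Ψ ∼[ set ] map apply (hyps Φ)
      concl-image : concl Ψ ≡ apply (concl Φ)
      DV-image   : applyDV (DV Φ) ⊆ᴰ DV Ψ

  OCᴾ : ∀ {n} → Vec MF n → Scheme → List MV
  OCᴾ P Φ = concatMap OC (toList P) ++ OCˢ Φ

  -- The pairs having at least one member outside OC(Φ).
  dummyDV : ∀ {n} → Vec MF n → Scheme → DVSet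
  dummyDV P Φ = record
    { Disj   = λ m n → Fresh m n ⊎ Fresh n m
    ; symm   = λ { (inj₁ f) → inj₂ f ; (inj₂ f) → inj₁ f }
    ; irrefl = λ { refl (inj₁ (_ , _ , _ , m≢m)) → m≢m refl
                 ; refl (inj₂ (_ , _ , _ , m≢m)) → m≢m refl }
    }
    where
    Fresh : Rel MV 0ℓ
    Fresh m n = m ∈ OCᴾ P Φ × m ∉ OCˢ Φ × n ∈ OCᴾ P Φ × m ≢ n

  DVᴾ : ∀ {n} → Vec MF n → Scheme → DVSet
  DVᴾ P Φ = DV Φ ∪ᴰ dummyDV P Φ

  record ProofOf (Φ : Scheme) (S : Pred Scheme (lsuc 0ℓ)) : Set₁ where
    field
      {len} : ℕ
      P     : Vec MF (suc len)
      ends  : last P ≡ concl Φ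
      steps : ∀ i → lookup P i ∈ hyps Φ
        ⊎ ∃[ js ] (All (_< i) js × ∃[ A ] (S A ×
            scheme (map (lookup P) js) (lookup P i) (DVᴾ P Φ) IsInstanceOf A))

  infix 4 _⊢_
  _⊢_ : Pred Scheme (lsuc 0ℓ) → Scheme → Set₁
  S ⊢ Φ = ProofOf Φ S

  IndependentIn : Scheme → Pred Scheme (lsuc 0ℓ) → Set₁
  IndependentIn Φ S = S Φ × ¬ (S ∖ ｛ Φ ｝ ⊢ Φ)

  x y z : VrMV
  x = x⟨ 0 ⟩
  y = x⟨ 1 ⟩
  z = x⟨ 2 ⟩

  φ ψ χ θ τ : MF
  φ = mv φ⟨ 0 ⟩
  ψ = mv φ⟨ 1 ⟩
  χ = mv φ⟨ 2 ⟩
  θ = mv φ⟨ 3 ⟩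
  τ = mv φ⟨ 4 ⟩

  DV[x,y] DV[x,φ] DV[y,φ] : DVSet
  DV[x,y] = dv (vr x⟨ 0 ⟩) (vr x⟨ 1 ⟩) (λ ())
  DV[x,φ] = dv (vr x⟨ 0 ⟩) (fm φ⟨ 0 ⟩) (λ ())
  DV[y,φ] = dv (vr x⟨ 1 ⟩) (fm φ⟨ 0 ⟩) (λ ())

  mp minimp peirce contrap notelim : Scheme
  mp      = scheme (φ ∷ φ ⇒ ψ ∷ []) ψ noDV
  minimp  = scheme [] (φ ⇒ ((ψ ⇒ χ) ⇒ (((θ ⇒ ψ) ⇒ (χ ⇒ τ)) ⇒ (ψ ⇒ τ)))) noDV
  peirce  = scheme [] (((φ ⇒ ψ) ⇒ φ) ⇒ φ) noDV
  contrap = scheme [] ((φ ⇒ ∼ ψ) ⇒ (ψ ⇒ ∼ φ)) noDV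
  notelim = scheme [] (∼ φ ⇒ (φ ⇒ ψ)) noDV

  gen ALLdistr spec modal5 vacGen ALLcomm : Scheme
  gen      = scheme (φ ∷ []) (∀[ x ] φ) noDV
  ALLdistr = scheme [] (∀[ x ] (φ ⇒ ψ) ⇒ (∀[ x ] φ ⇒ ∀[ x ] ψ)) noDV
  spec     = scheme [] (∀[ x ] φ ⇒ φ) noDV
  modal5   = scheme [] (∼ ∀[ x ] φ ⇒ ∀[ x ] ∼ ∀[ x ] φ) noDV
  vacGen   = scheme [] (φ ⇒ ∀[ x ] φ) DV[x,φ]
  ALLcomm  = scheme [] (∀[ x ] ∀[ y ] φ ⇒ ∀[ y ] ∀[ x ] φ) noDV

  EQrefl EQsymm EQtrans denot subst : Scheme
  EQrefl  = scheme [] (x ≐ x) noDV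
  EQsymm  = scheme [] (x ≐ y ⇒ y ≐ x) noDV
  EQtrans = scheme [] (x ≐ y ⇒ (y ≐ z ⇒ x ≐ z)) noDV
  denot   = scheme [] (x ≐ x ⇒ ∼ ∀[ y ] ∼ y ≐ x) DV[x,y]
  subst   = scheme [] (∀[ x ] (x ≐ y ⇒ (φ ⇒ ∀[ x ] (x ≐ y ⇒ φ)))) (DV[x,y] ∪ᴰ DV[y,φ])

  ALLeqWith : DVSet → Scheme
  ALLeqWith = scheme [] (∀[ x ] x ≐ y ⇒ (∀[ x ] φ ⇒ ∀[ y ] φ))

  ALLeq genEq : Scheme
  ALLeq = ALLeqWith noDV
  genEq = scheme [] (∼ ∀[ x ] x ≐ y ⇒ (∼ ∀[ x ] x ≐ z ⇒ (y ≐ z ⇒ ∀[ x ] y ≐ z))) noDV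

  TMM : Pred Scheme (lsuc 0ℓ)
  TMM = _∈ ( mp ∷ minimp ∷ peirce ∷ contrap ∷ notelim
           ∷ gen ∷ ALLdistr ∷ spec ∷ modal5 ∷ vacGen ∷ ALLcomm
           ∷ EQrefl ∷ EQsymm ∷ EQtrans ∷ denot ∷ subst
           ∷ ALLeq ∷ genEq ∷ [])

{-# OPTIONS --safe #-}

-- A Kripke model in which every instance of every axiom is valid, but ALLeq
-- itself is not. Metavariables live in blocks: x, y and φ share one block and
-- every other metavariable is alone in its own, so that any two metavariables
-- which a proof of ALLeq may assume disjoint are in distinct blocks. A world
-- assigns to each block a value and a flag; u ≐ v compares values and a formula
-- metavariable reads a flag. Quantifying over u ranges over all values of the
-- block of u, and quantifying over x moreover raises the flag of its block
-- (this breaks spec). Then ∀[ x ] x ≐ y and ∀[ x ] φ are valid but ∀[ y ] φ is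
-- not. As there are two values, ∀[ u ] u ≐ v holds only if u and v share a
-- block, so each weakened ALLeq is vacuous or concerns a formula independent
-- of the block of u and v.
module Submission where

open import Defs
open import Data.Bool using (Bool; true; false; not; if_then_else_)
import Data.Bool.Properties as Bool
open import Data.Empty using (⊥-elim)
open import Data.Fin using (_<_; fromℕ)
open import Data.Fin.Induction using (<-wellFounded)
open import Data.List using ([]; _∷_)
open import Data.List.Membership.Propositional using (_∈_; _∉_)
open import Data.List.Membership.Propositional.Properties using (∈-map⁺; ∈-map⁻; ∈-++⁺ˡ; ∈-++⁺ʳ)
open import Data.List.Relation.Unary.All using (All; []; _∷_)
import Data.List.Relation.Unary.All as All
open import Data.List.Relation.Unary.Any using (here; there)
open import Data.Nat using (zero; suc)
import Data.Nat.Properties as ℕ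
open import Data.Product using (_×_; _,_; proj₁; ∃-syntax)
open import Data.Sum using (inj₁; inj₂)
open import Data.Unit using (⊤; tt)
open import Data.Vec using (Vec; _∷_; []; lookup; last)
open import Function using (_∘_; Equivalence)
open import Induction.WellFounded using (Acc; acc)
open import Level using (0ℓ) renaming (suc to lsuc)
open import Relation.Binary using (DecidableEquality)
open import Relation.Binary.PropositionalEquality
  using (_≡_; _≢_; refl; sym; trans; cong; subst; ≢-sym; module ≡-Reasoning)
open import Relation.Nullary using (¬_; Dec; yes; no; does; contradiction)
open import Relation.Nullary.Decidable using (map′; _×-dec_; _→-dec_; ¬?; dec-false; dec-true)
open import Relation.Unary using (Pred; _∖_; _∪_; ｛_｝)

infix 4 _≟ⱽ_ _≟_

_≟ⱽ_ : DecidableEquality VrMV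
x⟨ i ⟩ ≟ⱽ x⟨ j ⟩ = map′ (cong x⟨_⟩) (λ { refl → refl }) (i ℕ.≟ j)

_≟_ : DecidableEquality MV
vr u ≟ vr v = map′ (cong vr) (λ { refl → refl }) (u ≟ⱽ v)
vr _ ≟ fm _ = no λ ()
fm _ ≟ vr _ = no λ ()
fm φ⟨ i ⟩ ≟ fm φ⟨ j ⟩ = map′ (cong (fm ∘ φ⟨_⟩)) (λ { refl → refl }) (i ℕ.≟ j)

open import Data.List.Membership.DecPropositional _≟_ using (_∈?_)

last≡lookup : ∀ {A : Set} {n} (xs : Vec A (suc n)) → last xs ≡ lookup xs (fromℕ n)
last≡lookup (_ ∷ [])          = refl
last≡lookup (_ ∷ xs@(_ ∷ _)) = last≡lookup xs

-- Worlds and their updates, for an arbitrary choice of blocks.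

module Model (𝓛 : Language) (block : MV → MV) where
  open System 𝓛 renaming (subst to substˢ)

  blockⱽ : VrMV → MV
  blockⱽ u = block (vr u)

  record State : Set where
    constructor ⟨_,_⟩
    field
      value flag : Bool
  open State

  World : Set
  World = MV → State

  -- Depends on the variable and not on its block: `y` may share the block of `x` and still leave
  -- the flag alone.
  raise : VrMV → Bool → Bool
  raise x⟨ zero ⟩  _ = true
  raise x⟨ suc _ ⟩ t = t

  raise-idem : ∀ u t → raise u (raise u t) ≡ raise u t
  raise-idem x⟨ zero ⟩  _ = refl
  raise-idem x⟨ suc _ ⟩ _ = refl

  raise-comm : ∀ u v t → raise u (raise v t) ≡ raise v (raise u t)
  raise-comm x⟨ zero ⟩  x⟨ zero ⟩  _ = refl
  raise-comm x⟨ zero ⟩  x⟨ suc _ ⟩ _ = refl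
  raise-comm x⟨ suc _ ⟩ x⟨ _ ⟩       _ = refl

  _[_≔_] : World → VrMV → Bool → World
  (w [ u ≔ b ]) k = if does (k ≟ blockⱽ u) then ⟨ b , raise u (flag (w k)) ⟩ else w k

  update-cong : ∀ w w′ u b {k} → w k ≡ w′ k → (w [ u ≔ b ]) k ≡ (w′ [ u ≔ b ]) k
  update-cong w w′ u b {k} = cong λ s → if does (k ≟ blockⱽ u) then ⟨ b , raise u (flag s) ⟩ else s

  update-other : ∀ w u b {k} → k ≢ blockⱽ u → (w [ u ≔ b ]) k ≡ w k
  update-other w u b {k} k≢u with k ≟ blockⱽ u
  ... | yes k≡u = contradiction k≡u k≢u
  ... | no _    = refl

  value-update : ∀ w u b → value ((w [ u ≔ b ]) (blockⱽ u)) ≡ b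
  value-update w u b with blockⱽ u ≟ blockⱽ u
  ... | yes _  = refl
  ... | no u≢u = contradiction refl u≢u

  update-idem : ∀ w u a b k → ((w [ u ≔ a ]) [ u ≔ b ]) k ≡ (w [ u ≔ b ]) k
  update-idem w u a b k with k ≟ blockⱽ u
  ... | yes _ = cong ⟨ b ,_⟩ (raise-idem u _)
  ... | no _  = refl

  -- If u and v share a block, the value set last survives.
  update-comm : ∀ w u v a b → ∃[ a′ ] ∃[ b′ ] ∀ k →
    ((w [ u ≔ a′ ]) [ v ≔ b′ ]) k ≡ ((w [ v ≔ b ]) [ u ≔ a ]) k
  update-comm w u v a b with blockⱽ u ≟ blockⱽ v
  ... | yes u≡v = b , a , same
    where
    same : ∀ k → ((w [ u ≔ b ]) [ v ≔ a ]) k ≡ ((w [ v ≔ b ]) [ u ≔ a ]) k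
    same k with k ≟ blockⱽ u | k ≟ blockⱽ v
    ... | yes _   | yes _   = cong ⟨ a ,_⟩ (raise-comm v u _)
    ... | yes k≡u | no k≢v  = contradiction (trans k≡u u≡v) k≢v
    ... | no k≢u  | yes k≡v = contradiction (trans k≡v (sym u≡v)) k≢u
    ... | no _    | no _    = refl
  ... | no u≢v = a , b , apart
    where
    apart : ∀ k → ((w [ u ≔ a ]) [ v ≔ b ]) k ≡ ((w [ v ≔ b ]) [ u ≔ a ]) k
    apart k with k ≟ blockⱽ u | k ≟ blockⱽ v
    ... | yes k≡u | yes k≡v = contradiction (trans (sym k≡u) k≡v) u≢v
    ... | yes _   | no _    = refl
    ... | no _    | yes _   = refl
    ... | no _    | no _    = refl

  -- Truth at a world.

  infix 4 _⊨_
  _⊨_ : World → MF → Set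
  w ⊨ mv a      = flag (w (block (fm a))) ≡ true
  w ⊨ u ≐ v     = value (w (blockⱽ u)) ≡ value (w (blockⱽ v))
  w ⊨ atom _ _  = ⊤
  w ⊨ ∀[ u ] A  = ∀ b → w [ u ≔ b ] ⊨ A
  w ⊨ ∼ A       = ¬ (w ⊨ A)
  w ⊨ A ⇒ B     = w ⊨ A → w ⊨ B

  -- A quantifier ranges over two values only, so truth is computable; `peirce` needs this case
  -- split.
  _⊨?_ : ∀ w A → Dec (w ⊨ A)
  w ⊨? mv a     = _ Bool.≟ _
  w ⊨? (u ≐ v)  = _ Bool.≟ _
  w ⊨? atom _ _ = yes tt
  w ⊨? (∀[ u ] A) = map′
    (λ (p , q) → λ { true → p ; false → q }) (λ f → f true , f false)
    ((w [ u ≔ true ]) ⊨? A ×-dec (w [ u ≔ false ]) ⊨? A)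
  w ⊨? (∼ A)    = ¬? (w ⊨? A)
  w ⊨? (A ⇒ B)  = (w ⊨? A) →-dec (w ⊨? B)

  coincidence : ∀ A {w w′} → (∀ {m} → m ∈ OC A → w (block m) ≡ w′ (block m)) →
    w ⊨ A → w′ ⊨ A
  coincidence (mv a)     e p = trans (cong flag (sym (e (here refl)))) p
  coincidence (u ≐ v)    e p = trans (cong value (sym (e (here refl))))
    (trans p (cong value (e (there (here refl)))))
  coincidence (atom _ _) e _ = tt
  coincidence (∀[ u ] A) {w} {w′} e p b =
    coincidence A (λ m∈ → update-cong w w′ u b (e (there m∈))) (p b)
  coincidence (∼ A)      e p q = p (coincidence A (sym ∘ e) q)
  coincidence (A ⇒ B)    e p q = coincidence B (e ∘ ∈-++⁺ʳ (OC A))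
    (p (coincidence A (sym ∘ e ∘ ∈-++⁺ˡ) q))

  ⊨-resp : ∀ A {w w′} → (∀ k → w k ≡ w′ k) → w ⊨ A → w′ ⊨ A
  ⊨-resp A e = coincidence A (λ {m} _ → e (block m))

  -- Bound occurrences count as well, in line with the disjoint variable conditions.
  _FreeFrom_ : MF → MV → Set
  A FreeFrom k = ∀ {m} → m ∈ OC A → block m ≢ k

  ⊨-update : ∀ A {w u} b → A FreeFrom blockⱽ u → w ⊨ A → w [ u ≔ b ] ⊨ A
  ⊨-update A {w} {u} b free = coincidence A (λ m∈ → sym (update-other w u b (free m∈)))

  ⊨-update⁻ : ∀ A {w u} b → A FreeFrom blockⱽ u → w [ u ≔ b ] ⊨ A → w ⊨ A
  ⊨-update⁻ A {w} {u} b free = coincidence A (λ m∈ → update-other w u b (free m∈))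

  -- Soundness of the schemes.

  Valid : MF → Set
  Valid A = ∀ w → w ⊨ A

  -- Strengthens legitimacy: the images must not even meet a common block.
  Separates : Substitution → DVSet → Set
  Separates σ D = ∀ {m n} → Disj D m n →
    ∀ {k l} → k ∈ OCσ m → l ∈ OCσ n → block k ≢ block l
    where open Substitution σ

  Sound : Scheme → Set
  Sound A = ∀ σ → Separates σ (DV A) → let open Substitution σ in
    (∀ {B} → B ∈ hyps A → Valid (apply B)) → Valid (apply (concl A))

  valid-peirce : ∀ A B → Valid (((A ⇒ B) ⇒ A) ⇒ A)
  valid-peirce A B w f with w ⊨? A
  ... | yes p = p
  ... | no ¬p = f (λ p → contradiction p ¬p)

  -- A second update of `u` absorbs the first, so updating `u` does not affect the truth of
  -- `∀[ u ] A`.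
  valid-modal5 : ∀ u A → Valid (∼ ∀[ u ] A ⇒ ∀[ u ] ∼ ∀[ u ] A)
  valid-modal5 u A w ¬p a q = ¬p λ b → ⊨-resp A (update-idem w u a b) (q b)

  valid-ALLcomm : ∀ u v A → Valid (∀[ u ] ∀[ v ] A ⇒ ∀[ v ] ∀[ u ] A)
  valid-ALLcomm u v A w p b a =
    let a′ , b′ , e = update-comm w u v a b in ⊨-resp A e (p a′ b′)

  valid-denot : ∀ u v → blockⱽ u ≢ blockⱽ v → Valid (u ≐ u ⇒ ∼ ∀[ v ] ∼ v ≐ u)
  -- The witness is the value of `u`, which an update of `v` leaves alone.
  valid-denot u v u≢v w _ p = p (value (w (blockⱽ u)))
    (trans (value-update w v _) (cong value (sym (update-other w v _ u≢v))))

  -- Both equations tie the value of `u` to the untouched value of `v`, so `a` and `b` agree. The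
  -- outer quantifier has already raised the flag, hence the second update changes nothing.
  valid-subst : ∀ u v A → blockⱽ u ≢ blockⱽ v →
    Valid (∀[ u ] (u ≐ v ⇒ (A ⇒ ∀[ u ] (u ≐ v ⇒ A))))
  valid-subst u v A u≢v w a a≡v p b b≡v =
    ⊨-resp A (λ k → sym (trans (update-idem w u a b k) (cong (λ c → (w [ u ≔ c ]) k) b≡a))) p
    where
    open ≡-Reasoning
    b≡a : b ≡ a
    b≡a = begin
      b                                                 ≡⟨ value-update (w [ u ≔ a ]) u b ⟨
      value (((w [ u ≔ a ]) [ u ≔ b ]) (blockⱽ u))      ≡⟨ b≡v ⟩
      value (((w [ u ≔ a ]) [ u ≔ b ]) (blockⱽ v))      ≡⟨ cong value (update-other (w [ u ≔ a ]) u b (≢-sym u≢v)) ⟩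
      value ((w [ u ≔ a ]) (blockⱽ v))                  ≡⟨ a≡v ⟨
      value ((w [ u ≔ a ]) (blockⱽ u))                  ≡⟨ value-update w u a ⟩
      a                                                 ∎

  shared-block⇒≐ : ∀ {u v} → blockⱽ u ≡ blockⱽ v → Valid (u ≐ v)
  shared-block⇒≐ u≡v w = cong (value ∘ w) u≡v

  -- If `u` shares a block with `v` or `t`, one of the negated premises fails; otherwise updating
  -- `u` affects neither side of `v ≐ t`.
  valid-genEq : ∀ u v t →
    Valid (∼ ∀[ u ] u ≐ v ⇒ (∼ ∀[ u ] u ≐ t ⇒ (v ≐ t ⇒ ∀[ u ] v ≐ t)))
  valid-genEq u v t w ¬u≐v ¬u≐t p b with blockⱽ u ≟ blockⱽ v | blockⱽ u ≟ blockⱽ t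
  ... | yes u≡v | _       = ⊥-elim (¬u≐v λ c → shared-block⇒≐ u≡v (w [ u ≔ c ]))
  ... | no _    | yes u≡t = ⊥-elim (¬u≐t λ c → shared-block⇒≐ u≡t (w [ u ≔ c ]))
  ... | no u≢v  | no u≢t  = trans (cong value (update-other w u b (≢-sym u≢v)))
    (trans p (cong value (sym (update-other w u b (≢-sym u≢t)))))

  ∀≐⇒shared-block : ∀ {w} u v → w ⊨ ∀[ u ] u ≐ v → blockⱽ u ≡ blockⱽ v
  ∀≐⇒shared-block {w} u v p with blockⱽ u ≟ blockⱽ v
  ... | yes u≡v = u≡v
  ... | no u≢v  = ⊥-elim (Bool.not-¬ refl (sym (trans (sym (value-update w u b))
    (trans (p b) (cong value (update-other w u b (≢-sym u≢v)))))))
    -- The value that the block of `v` does not have.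
    where b = not (value (w (blockⱽ v)))

  -- The first premise forces a shared block, on which `A` then does not depend, so both quantifiers
  -- over `A` are vacuous.
  valid-ALLeq : ∀ u v A → (blockⱽ u ≡ blockⱽ v → A FreeFrom blockⱽ u) →
    Valid (∀[ u ] u ≐ v ⇒ (∀[ u ] A ⇒ ∀[ v ] A))
  valid-ALLeq u v A free w p q b = ⊨-update A {w} {v} b (subst (A FreeFrom_) u≡v free′)
    (⊨-update⁻ A {w} {u} b free′ (q b))
    where
    u≡v = ∀≐⇒shared-block {w} u v p
    free′ : A FreeFrom blockⱽ u
    free′ = free u≡v

  -- The exclusions sit inside the predicate so that one lookup along a membership proof in `TMM`
  -- serves every axiom.
  sound-TMM : All (λ A → A ≢ spec → A ≢ ALLeq → Sound A)
    ( mp ∷ minimp ∷ peirce ∷ contrap ∷ notelim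
    ∷ gen ∷ ALLdistr ∷ spec ∷ modal5 ∷ vacGen ∷ ALLcomm
    ∷ EQrefl ∷ EQsymm ∷ EQtrans ∷ denot ∷ substˢ
    ∷ ALLeq ∷ genEq ∷ [])
  sound-TMM =
      (λ _ _ σ s h w → h (there (here refl)) w (h (here refl) w))
    ∷ (λ _ _ σ s h w a f g b → g (λ _ → b) (f b))
    ∷ (λ _ _ σ s h → valid-peirce _ _)
    ∷ (λ _ _ σ s h w f b a → f a b)
    ∷ (λ _ _ σ s h w ¬a a → ⊥-elim (¬a a))
    ∷ (λ _ _ σ s h w b → h (here refl) _)
    ∷ (λ _ _ σ s h w f p b → f b (p b))
    ∷ (λ ≢spec _ → contradiction refl ≢spec)
    ∷ (λ _ _ σ s h → valid-modal5 _ _)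
    ∷ (λ _ _ σ s h w p b → ⊨-update _ {w} b
        (λ m∈ → ≢-sym (s (inj₁ (refl , refl) , there (here refl) , here refl) (here refl) m∈)) p)
    ∷ (λ _ _ σ s h → valid-ALLcomm _ _ _)
    ∷ (λ _ _ σ s h w → refl)
    ∷ (λ _ _ σ s h w → sym)
    ∷ (λ _ _ σ s h w → trans)
    ∷ (λ _ _ σ s h → valid-denot _ _
        (s (inj₁ (refl , refl) , here refl , there (there (here refl))) (here refl) (here refl)))
    ∷ (λ _ _ σ s h → valid-subst _ _ _
        (s (inj₁ (inj₁ (refl , refl)) , here refl , there (there (here refl))) (here refl) (here refl)))
    ∷ (λ _ ≢ALLeq → contradiction refl ≢ALLeq)
    ∷ (λ _ _ σ s h → valid-genEq _ _ _)
    ∷ []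

  -- The first condition rules out a shared block; the other two keep `φ` off the block of `x` or of
  -- `y`, which is the same block once shared.
  sound-weak-ALLeq : All (Sound ∘ ALLeqWith) (DV[x,y] ∷ DV[x,φ] ∷ DV[y,φ] ∷ [])
  sound-weak-ALLeq =
      (λ σ s h → valid-ALLeq _ _ _ λ u≡v → ⊥-elim
        (s (inj₁ (refl , refl) , x∈ , y∈) (here refl) (here refl) u≡v))
    ∷ (λ σ s h → valid-ALLeq _ _ _ λ _ m∈ →
        ≢-sym (s (inj₁ (refl , refl) , x∈ , φ∈) (here refl) m∈))
    ∷ (λ σ s h → valid-ALLeq _ _ _ λ u≡v m∈ m≡u →
        s (inj₁ (refl , refl) , y∈ , φ∈) (here refl) m∈ (sym (trans m≡u u≡v)))
    ∷ []
    where
    x∈ : vr x ∈ OCˢ ALLeq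
    x∈ = here refl
    y∈ : vr y ∈ OCˢ ALLeq
    y∈ = there (there (here refl))
    φ∈ : fm φ⟨ 0 ⟩ ∈ OCˢ ALLeq
    φ∈ = there (there (there (there (here refl))))

-- The blocks that refute `ALLeq`, and soundness of proofs.

module Countermodel (𝓛 : Language) where
  open System 𝓛 hiding (subst)

  block : MV → MV
  block m = if does (m ∈? OCˢ ALLeq) then vr x else m

  block-∈ : ∀ {m} → m ∈ OCˢ ALLeq → block m ≡ vr x
  block-∈ {m} m∈ = cong (if_then vr x else m) (dec-true (m ∈? OCˢ ALLeq) m∈)

  block-∉ : ∀ {m} → m ∉ OCˢ ALLeq → block m ≡ m
  block-∉ {m} m∉ = cong (if_then vr x else m) (dec-false (m ∈? OCˢ ALLeq) m∉)

  block-≢ : ∀ {m n} → m ∉ OCˢ ALLeq → m ≢ n → block m ≢ block n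
  block-≢ {m} {n} m∉ m≢n eq with n ∈? OCˢ ALLeq
  -- Here `m`, being its own block, would have to be `vr x`, which occurs in `ALLeq`.
  ... | yes n∈ = m∉ (here (trans (sym (block-∉ m∉)) (trans eq (block-∈ n∈))))
  ... | no n∉  = m≢n (trans (sym (block-∉ m∉)) (trans eq (block-∉ n∉)))

  open Model 𝓛 block public

  ALLeq-invalid : ¬ Valid (concl ALLeq)
  -- Both premises hold by computation, the second because `x` raises the flag; updating `y` leaves
  -- it false.
  ALLeq-invalid p with p (λ _ → ⟨ false , false ⟩) (λ _ → refl) (λ _ → refl) true
  ... | ()

  -- `ALLeq` has no conditions of its own, so every pair contains a dummy, which is alone in its
  -- block.
  DVᴾ-ALLeq⇒block-≢ : ∀ {n} (P : Vec MF n) {k l} → Disj (DVᴾ P ALLeq) k l → block k ≢ block l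
  DVᴾ-ALLeq⇒block-≢ P (inj₂ (inj₁ (_ , k∉ , _ , k≢l))) = block-≢ k∉ k≢l
  DVᴾ-ALLeq⇒block-≢ P (inj₂ (inj₂ (_ , l∉ , _ , l≢k))) = ≢-sym (block-≢ l∉ l≢k)

  module _ {S : Pred Scheme (lsuc 0ℓ)} (sound : ∀ {A} → S A → Sound A) where

    -- Well-founded induction on the position of the line; no line is a hypothesis, as `ALLeq` has
    -- none.
    lines-valid : (pf : ProofOf ALLeq S) → let open ProofOf pf in
      ∀ i → Acc _<_ i → Valid (lookup P i)
    lines-valid pf i (acc rec) with ProofOf.steps pf i
    ... | inj₂ (js , js<i , A , A∈S , inst) =
      subst Valid (sym concl-image) (sound A∈S σ separates hyps-valid)
      where
      open ProofOf pf
      open _IsInstanceOf_ inst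
      open Substitution σ

      separates : Separates σ (DV A)
      separates d k∈ l∈ = DVᴾ-ALLeq⇒block-≢ P
        -- Legitimacy makes the two metavariables distinct, as `applyDV` demands.
        (proj₁ (DV-image ((λ { refl → legitimate d (k∈ , l∈) }) , _ , _ , d , k∈ , l∈)))

      hyps-valid : ∀ {B} → B ∈ hyps A → Valid (apply B)
      hyps-valid B∈ with ∈-map⁻ _ (Equivalence.from hyps-image (∈-map⁺ apply B∈))
      ... | j , j∈ , eq = subst Valid (sym eq) (lines-valid pf j (rec (All.lookup js<i j∈)))

    ALLeq-unprovable : ¬ (S ⊢ ALLeq)
    ALLeq-unprovable pf = ALLeq-invalid
      (subst Valid (trans (sym (last≡lookup P)) ends) (lines-valid pf _ (<-wellFounded _)))
      where open ProofOf pf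

proposition3p10 : (𝓛 : Language) → let open System 𝓛 in
    All (λ D → ¬ ((TMM ∖ (｛ spec ｝ ∪ ｛ ALLeq ｝)) ∪ ｛ ALLeqWith D ｝ ⊢ ALLeq)) (DV[x,y] ∷ DV[x,φ] ∷ DV[y,φ] ∷ [])
    × IndependentIn ALLeq (TMM ∖ ｛ spec ｝)
proposition3p10 𝓛 =
    All.map (λ sound-D → ALLeq-unprovable λ
      { (inj₁ (A∈ , A∉)) → All.lookup sound-TMM A∈ (A∉ ∘ inj₁ ∘ sym) (A∉ ∘ inj₂ ∘ sym)
      ; (inj₂ refl)       → sound-D }) sound-weak-ALLeq
  , ( ALLeq∈TMM , λ spec≡ALLeq → spec≢ALLeq (cong concl spec≡ALLeq))
  , ALLeq-unprovable λ ((A∈ , A≢spec) , A≢ALLeq) →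
      All.lookup sound-TMM A∈ (A≢spec ∘ sym) (A≢ALLeq ∘ sym)
  where
  open System 𝓛
  open Countermodel 𝓛

  ALLeq∈TMM : TMM ALLeq
  ALLeq∈TMM = there (there (there (there (there (there (there (there (there (there
    (there (there (there (there (there (there (here refl))))))))))))))))

  spec≢ALLeq : concl spec ≢ concl ALLeq
  spec≢ALLeq ()
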